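{- For every positive integer $n$, $$\nu_2(\sigma(n)) \le \lceil \log_2 n\rceil,$$ and equality holds if and only if $n$ is a product of distinct Mersenne primes.
   Context: $\nu_2(m)$ denotes the exponent of the highest power of $2$ dividing the positive integer $m$, and $\sigma(n)$ is the sum of the positive divisors of $n$. A Mersenne prime is a prime of the form $2^a-1$ with $a$ a positive integer. The number $n=1$ is regarded as the empty product of Mersenne primes. -}

module Defs where

open import Data.List.Base using (List; map; filter; upTo)
open import Data.List.Relation.Unary.All using (All)
open import Data.List.Relation.Unary.Unique.Propositional using (Unique)
open import Data.Nat.Base using (ℕ; zero; suc; _∸_; _^_; _≤_)
open import Data.Nat.Divisibility using (_∣?_)
open import Data.Nat.ListAction using (sum; product)
open import Data.Nat.Primality using (Prime)
open import Data.Product.Base using (_×_; ∃-syntax)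
open import Relation.Binary.PropositionalEquality.Core using (_≡_)
open import Relation.Nullary.Decidable.Core using (yes; no)

-- The largest k ≤ b such that 2 ^ k divides m (k = 0 always qualifies).
maxExponent₂ : (b m : ℕ) → ℕ
maxExponent₂ zero    m = zero
maxExponent₂ (suc b) m with (2 ^ suc b) ∣? m
... | yes _ = suc b
... | no  _ = maxExponent₂ b m

-- For positive m, 2 ^ k ∣ m forces k < 2 ^ k ≤ m, so searching k ≤ m loses
-- nothing.  The value at m = 0 is 0 by convention.
ν₂ : ℕ → ℕ
ν₂ m = maxExponent₂ m m

divisors : ℕ → List ℕ
divisors n = filter (_∣? n) (map suc (upTo n))

σ : ℕ → ℕ
σ n = sum (divisors n)

-- 2 ^ a is never 0, so the truncated subtraction is exact.
MersennePrime : ℕ → Set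
MersennePrime p = Prime p × (∃[ a ] 1 ≤ a × p ≡ 2 ^ a ∸ 1)

-- The list may be empty, so 1 is such a product.
ProductOfDistinctMersennePrimes : ℕ → Set
ProductOfDistinctMersennePrimes n =
  ∃[ ps ] All MersennePrime ps × Unique ps × product ps ≡ n

{-# OPTIONS --safe #-}
module Submission where

-- Let V n = 2 ^ ν₂ (σ n), which is multiplicative on coprime arguments.  A prime
-- power q = p ^ e has V q = p + 1 if q is a Mersenne prime and 2 V q ≤ q
-- otherwise, and the product of 2 ^ c / (2 ^ c − 1) over all c ≥ 2 is less than 2.
-- Hence n ≤ V n < 2 n if n is a product of distinct Mersenne primes, and V n < n
-- otherwise; finally V n < 2 n gives ν₂ (σ n) ≤ ⌈log₂ n⌉, V n < n gives strict
-- inequality, and n ≤ V n gives the reverse one.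

open import Defs
open import Data.List.Base using ([]; _∷_; map; upTo; _++_)
open import Data.List.Membership.Propositional using (_∈_)
open import Data.List.Membership.Propositional.Properties using (∈-map⁺; ∈-map⁻; ∈-filter⁺; ∈-filter⁻; ∈-upTo⁺; ∈-++⁺ˡ; ∈-++⁺ʳ; ∈-++⁻)
open import Data.List.Membership.Propositional.Properties.WithK using (unique∧set⇒bag)
open import Data.List.Relation.Binary.BagAndSetEquality using (∼bag⇒↭)
open import Data.List.Relation.Binary.Permutation.Propositional using (_↭_)
open import Data.List.Relation.Unary.All as All using (All; []; _∷_)
open import Data.List.Relation.Unary.AllPairs using ([]; _∷_)
open import Data.List.Relation.Unary.Any using (here; there)
open import Data.List.Relation.Unary.Unique.Propositional using (Unique)
import Data.List.Relation.Unary.Unique.Propositional.Properties as Unique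
open import Data.Nat
open import Data.Nat.Divisibility
open import Data.Nat.Induction using (<-rec)
open import Data.Nat.ListAction using (sum; product)
open import Data.Nat.ListAction.Properties using (sum-++; sum-↭; ∈⇒∣product)
open import Data.Nat.Logarithm
open import Data.Nat.Primality
open import Data.Nat.Primality.Factorisation using (factorisationHasAllPrimeFactors)
open import Data.Nat.Properties
open import Data.Nat.Tactic.RingSolver using (solve-∀)
open import Data.Product.Base using (_×_; _,_; ∃-syntax; proj₁; proj₂)
open import Data.Sum.Base using (_⊎_; inj₁; inj₂)
open import Function.Bundles using (_⇔_; mk⇔)
open import Relation.Nullary using (¬_; yes; no; contradiction)
open import Relation.Binary.PropositionalEquality

-- Parity and the largest power of 2 dividing a number

even-or-odd : ∀ n → (∃[ k ] n ≡ 2 * k) ⊎ (∃[ k ] n ≡ 1 + 2 * k)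
even-or-odd zero    = inj₁ (0 , refl)
even-or-odd (suc n) with even-or-odd n
... | inj₁ (k , refl) = inj₂ (k , refl)
... | inj₂ (k , refl) = inj₁ (suc k , sym (*-suc 2 k))

2∤odd : ∀ o → 2 ∤ 1 + 2 * o
2∤odd o 2∣1+2o with () ← ∣1⇒≡1 (∣m+n∣m⇒∣n (subst (2 ∣_) (+-comm 1 (2 * o)) 2∣1+2o) (m∣m*n o))

-- The search descends from `b`: maximality rules out stopping above `k`, and `k ≤ b` ensures that
-- `k` is reached.
maxExponent₂-unique : ∀ b {m k} → k ≤ b → 2 ^ k ∣ m →
                      (∀ {j} → k < j → 2 ^ j ∤ m) → maxExponent₂ b m ≡ k
maxExponent₂-unique zero z≤n _ _ = refl
maxExponent₂-unique (suc b) {m} {k} k≤1+b 2^k∣m max with (2 ^ suc b) ∣? m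
... | yes 2^1+b∣m = ≤-antisym (≮⇒≥ λ k<1+b → max k<1+b 2^1+b∣m) k≤1+b
... | no  2^1+b∤m = maxExponent₂-unique b (m<1+n⇒m≤n (≤∧≢⇒< k≤1+b λ { refl → 2^1+b∤m 2^k∣m })) 2^k∣m max

n<2^n : ∀ n → n < 2 ^ n
n<2^n zero    = s≤s z≤n
n<2^n (suc n) = begin-strict
  suc n         ≤⟨ n<2^n n ⟩
  2 ^ n         <⟨ m<n+m (2 ^ n) (m^n>0 2 n) ⟩
  2 ^ n + 2 ^ n ≡⟨ cong (2 ^ n +_) (sym (+-identityʳ (2 ^ n))) ⟩
  2 ^ suc n     ∎
  where open ≤-Reasoning

ν₂-2^k*odd : ∀ k o → ν₂ (2 ^ k * (1 + 2 * o)) ≡ k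
ν₂-2^k*odd k o = maxExponent₂-unique m k≤m (m∣m*n (1 + 2 * o)) maximal
  where
  m = 2 ^ k * (1 + 2 * o)
  instance _ = m^n≢0 2 k
  k≤m : k ≤ m
  k≤m = ≤-trans (<⇒≤ (n<2^n k)) (m≤m*n (2 ^ k) (1 + 2 * o))
  maximal : ∀ {j} → k < j → 2 ^ j ∤ m
  -- Cancelling `2 ^ k` from `2 ^ (1 + k) ∣ m` would leave 2 dividing an odd number.
  maximal {j} k<j 2^j∣m = 2∤odd o (*-cancelˡ-∣ (2 ^ k)
    (subst (_∣ m) (*-comm 2 (2 ^ k)) (∣-trans (m≤n⇒2^m∣2^n k<j) 2^j∣m)))
    where
    m≤n⇒2^m∣2^n : ∀ {m n} → m ≤ n → 2 ^ m ∣ 2 ^ n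
    m≤n⇒2^m∣2^n {m} {n} m≤n = subst (2 ^ m ∣_)
      (trans (sym (^-distribˡ-+-* 2 m (n ∸ m))) (cong (2 ^_) (m+[n∸m]≡n m≤n)))
      (m∣m*n (2 ^ (n ∸ m)))

2^k*odd-decomposition : ∀ n → 0 < n → ∃[ k ] ∃[ o ] n ≡ 2 ^ k * (1 + 2 * o)
2^k*odd-decomposition = <-rec P step
  where
  P : ℕ → Set
  P n = 0 < n → ∃[ k ] ∃[ o ] n ≡ 2 ^ k * (1 + 2 * o)
  step : ∀ n → (∀ {m} → m < n → P m) → P n
  step n rec 0<n with even-or-odd n
  ... | inj₂ (o , refl) = 0 , o , sym (*-identityˡ (1 + 2 * o))
  ... | inj₁ (suc h , refl) with rec (m<m+n (suc h) (s≤s z≤n)) (s≤s z≤n)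
  ...   | k , o , h≡ = suc k , o , trans (cong (2 *_) h≡) (sym (*-assoc 2 (2 ^ k) (1 + 2 * o)))

-- The power itself, not its exponent, is multiplicative and directly comparable with `n`, so
-- logarithms enter only at the very end.
2-part : ℕ → ℕ
2-part n = 2 ^ ν₂ n

2-part-2^k*odd : ∀ k o → 2-part (2 ^ k * (1 + 2 * o)) ≡ 2 ^ k
2-part-2^k*odd k o = cong (2 ^_) (ν₂-2^k*odd k o)

2-part-odd : ∀ o → 2-part (1 + 2 * o) ≡ 1
2-part-odd o = trans (cong 2-part (sym (*-identityˡ (1 + 2 * o)))) (2-part-2^k*odd 0 o)

2-part-2^ : ∀ k → 2-part (2 ^ k) ≡ 2 ^ k
2-part-2^ k = trans (cong 2-part (sym (*-identityʳ (2 ^ k)))) (2-part-2^k*odd k 0)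

2-part-≤ : ∀ n → 0 < n → 2-part n ≤ n
2-part-≤ n 0<n with 2^k*odd-decomposition n 0<n
... | k , o , refl = subst (_≤ 2 ^ k * (1 + 2 * o)) (sym (2-part-2^k*odd k o)) (m≤m*n (2 ^ k) (1 + 2 * o))

2-part-* : ∀ m n → 0 < m → 0 < n → 2-part (m * n) ≡ 2-part m * 2-part n
2-part-* m n 0<m 0<n with 2^k*odd-decomposition m 0<m | 2^k*odd-decomposition n 0<n
... | k , o , refl | l , q , refl = begin
  2-part (2 ^ k * (1 + 2 * o) * (2 ^ l * (1 + 2 * q)))
    ≡⟨ cong 2-part (rearrange (2 ^ k) (2 ^ l) o q) ⟩
  2-part (2 ^ k * 2 ^ l * (1 + 2 * (o + q + 2 * (o * q))))
    ≡⟨ cong (λ x → 2-part (x * (1 + 2 * (o + q + 2 * (o * q))))) (sym (^-distribˡ-+-* 2 k l)) ⟩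
  2-part (2 ^ (k + l) * (1 + 2 * (o + q + 2 * (o * q))))
    ≡⟨ 2-part-2^k*odd (k + l) (o + q + 2 * (o * q)) ⟩
  2 ^ (k + l)
    ≡⟨ ^-distribˡ-+-* 2 k l ⟩
  2 ^ k * 2 ^ l
    ≡⟨ sym (cong₂ _*_ (2-part-2^k*odd k o) (2-part-2^k*odd l q)) ⟩
  2-part (2 ^ k * (1 + 2 * o)) * 2-part (2 ^ l * (1 + 2 * q)) ∎
  where
  open ≡-Reasoning
  rearrange : ∀ a b o q → a * (1 + 2 * o) * (b * (1 + 2 * q)) ≡ a * b * (1 + 2 * (o + q + 2 * (o * q)))
  rearrange = solve-∀

-- Geometric sums and their 2-parts

-- Horner form of 1 + q + ... + q ^ e, which is σ (q ^ e) when q is prime.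
geometric : ℕ → ℕ → ℕ
geometric q zero    = 1
geometric q (suc e) = 1 + q * geometric q e

geometric>0 : ∀ q e → 0 < geometric q e
geometric>0 q zero    = s≤s z≤n
geometric>0 q (suc e) = s≤s z≤n

-- The number of terms is even, and neighbours pair up as q ^ (2 j) + q ^ (2 j + 1) = (1 + q) (q *
-- q) ^ j. This drives the recursion that squares `q`.
geometric-1+2* : ∀ q i → geometric q (1 + 2 * i) ≡ (1 + q) * geometric (q * q) i
geometric-1+2* q zero    = base q
  where
  base : ∀ q → 1 + q * 1 ≡ (1 + q) * 1
  base = solve-∀
geometric-1+2* q (suc i) = begin
  geometric q (1 + 2 * suc i)                    ≡⟨ cong (λ j → geometric q (1 + j)) (*-suc 2 i) ⟩
  1 + q * (1 + q * geometric q (1 + 2 * i))      ≡⟨ cong (λ g → 1 + q * (1 + q * g)) (geometric-1+2* q i) ⟩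
  1 + q * (1 + q * ((1 + q) * geometric (q * q) i)) ≡⟨ step q (geometric (q * q) i) ⟩
  (1 + q) * geometric (q * q) (suc i)            ∎
  where
  open ≡-Reasoning
  step : ∀ q g → 1 + q * (1 + q * ((1 + q) * g)) ≡ (1 + q) * (1 + q * q * g)
  step = solve-∀

-- An odd number of odd terms has an odd sum.
geometric-odd : ∀ u i → ∃[ o ] geometric (1 + 2 * u) (2 * i) ≡ 1 + 2 * o
geometric-odd u zero    = 0 , refl
geometric-odd u (suc i) with geometric-odd u i
-- The witness is half of q + q * q * (1 + 2 * o), using q * q = 1 + 2 * (2 * u + 2 * (u * u)).
... | o , g≡ = o + (2 * u + 2 * (u * u)) * (1 + 2 * o) + 1 + u , (begin
  geometric q (2 * suc i)                  ≡⟨ cong (geometric q) (*-suc 2 i) ⟩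
  1 + q * (1 + q * geometric q (2 * i))    ≡⟨ cong (λ g → 1 + q * (1 + q * g)) g≡ ⟩
  1 + q * (1 + q * (1 + 2 * o))            ≡⟨ step u o ⟩
  1 + 2 * (o + (2 * u + 2 * (u * u)) * (1 + 2 * o) + 1 + u) ∎)
  where
  open ≡-Reasoning
  q = 1 + 2 * u
  step : ∀ u o → 1 + (1 + 2 * u) * (1 + (1 + 2 * u) * (1 + 2 * o)) ≡
                 1 + 2 * (o + (2 * u + 2 * (u * u)) * (1 + 2 * o) + 1 + u)
  step = solve-∀

2-part-geometric-even : ∀ u i → 2-part (geometric (1 + 2 * u) (2 * i)) ≡ 1
2-part-geometric-even u i with geometric-odd u i
... | o , g≡ = trans (cong 2-part g≡) (2-part-odd o)

2-part-geometric-1+2* : ∀ q i → 2-part (geometric q (1 + 2 * i)) ≡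
                                2-part (1 + q) * 2-part (geometric (q * q) i)
2-part-geometric-1+2* q i = trans (cong 2-part (geometric-1+2* q i))
  (2-part-* (1 + q) (geometric (q * q) i) (s≤s z≤n) (geometric>0 (q * q) i))

m≤m^1+n : ∀ m n .{{_ : NonZero m}} → m ≤ m ^ suc n
m≤m^1+n m n = m≤m*n m (m ^ n) {{m^n≢0 m n}}

^-1+2* : ∀ q i → q ^ (1 + 2 * i) ≡ q * (q * q) ^ i
^-1+2* q i = cong (q *_) (trans (sym (^-*-assoc q 2 i)) (cong (λ r → (q * r) ^ i) (*-identityʳ q)))

-- Here 1 + q ≡ 2 (mod 4), so each step e ↦ 1 + 2 e doubles the 2-part while
-- q is squared.  The factor 3, rather than 2, absorbs the quotient (1 + p) / p
-- when the bound is applied to q = p * p.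
3*2-part-geometric≤ : ∀ e → 0 < e → ∀ t → let q = 1 + 2 * (2 * (2 + t)) in
                      3 * 2-part (geometric q e) ≤ q ^ e
3*2-part-geometric≤ = <-rec P step
  where
  P : ℕ → Set
  P e = 0 < e → ∀ t → let q = 1 + 2 * (2 * (2 + t)) in 3 * 2-part (geometric q e) ≤ q ^ e
  -- The shape `1 + 2 * (2 * (2 + t))` encodes q ≡ 1 (mod 4) and q ≥ 9, the least square of an odd
  -- prime. Squaring preserves it; the case e = 1 needs q ≥ 6.
  square : ∀ t → (1 + 2 * (2 * (2 + t))) * (1 + 2 * (2 * (2 + t))) ≡
                 1 + 2 * (2 * (2 + (18 + 18 * t + 4 * (t * t))))
  square = solve-∀
  q≡ : ∀ t → 1 + 2 * (2 * (2 + t)) ≡ 9 + 4 * t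
  q≡ = solve-∀
  swap : ∀ w → 3 * (2 * w) ≡ 2 * (3 * w)
  swap = solve-∀
  k≤q : ∀ t k → k ≤ 9 → k ≤ 1 + 2 * (2 * (2 + t))
  k≤q t k k≤9 = subst (k ≤_) (sym (q≡ t)) (≤-trans k≤9 (m≤m+n 9 (4 * t)))
  2-part-1+q : ∀ t → 2-part (2 + 2 * (2 * (2 + t))) ≡ 2
  2-part-1+q t = trans (cong 2-part (sym (*-suc 2 (2 * (2 + t))))) (2-part-2^k*odd 1 (2 + t))
  step : ∀ e → (∀ {d} → d < e → P d) → P e
  step e rec 0<e t with even-or-odd e
  ... | inj₁ (suc k , refl) = begin
    3 * 2-part (geometric q (2 * suc k)) ≡⟨ cong (3 *_) (2-part-geometric-even (2 * (2 + t)) (suc k)) ⟩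
    3                                   ≤⟨ k≤q t 3 (s≤s (s≤s (s≤s z≤n))) ⟩
    q                                   ≤⟨ m≤m^1+n q (k + 1 * suc k) ⟩
    q ^ (2 * suc k)                     ∎
    where
    open ≤-Reasoning
    q = 1 + 2 * (2 * (2 + t))
  ... | inj₂ (zero , refl) = begin
    3 * 2-part (geometric q 1) ≡⟨ cong (λ x → 3 * 2-part (1 + x)) (*-identityʳ q) ⟩
    3 * 2-part (1 + q)         ≡⟨ cong (3 *_) (2-part-1+q t) ⟩
    6                          ≤⟨ k≤q t 6 (m≤m+n 6 3) ⟩
    q                          ≡⟨ sym (*-identityʳ q) ⟩
    q ^ 1                      ∎
    where
    open ≤-Reasoning
    q = 1 + 2 * (2 * (2 + t))
  ... | inj₂ (suc k , refl) = begin
    3 * 2-part (geometric q (1 + 2 * suc k))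
      ≡⟨ cong (3 *_) (trans (2-part-geometric-1+2* q (suc k)) (cong (_* 2-part (geometric (q * q) (suc k))) (2-part-1+q t))) ⟩
    3 * (2 * 2-part (geometric (q * q) (suc k)))
      ≡⟨ swap (2-part (geometric (q * q) (suc k))) ⟩
    2 * (3 * 2-part (geometric (q * q) (suc k)))
      ≤⟨ *-mono-≤ (k≤q t 2 (m≤m+n 2 7)) ih ⟩
    q * (q * q) ^ suc k
      ≡⟨ sym (^-1+2* q (suc k)) ⟩
    q ^ (1 + 2 * suc k) ∎
    where
    open ≤-Reasoning
    q = 1 + 2 * (2 * (2 + t))
    ih : 3 * 2-part (geometric (q * q) (suc k)) ≤ (q * q) ^ suc k
    ih = subst (λ r → 3 * 2-part (geometric r (suc k)) ≤ r ^ suc k) (sym (square t))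
           (rec (m<n⇒m<1+n (m<m+n (suc k) (s≤s z≤n))) (s≤s z≤n) (18 + 18 * t + 4 * (t * t)))

-- Pairing terms splits off 1 + p, whose 2-part is at most 1 + p. The remaining sum in p * p gains
-- the factor 3, which pays for 2 (1 + p) ≤ 3 p.
2*2-part-geometric-odd≤ : ∀ v k → let p = 1 + 2 * suc v in
  2 * 2-part (geometric p (1 + 2 * suc k)) ≤ p ^ (1 + 2 * suc k)
2*2-part-geometric-odd≤ v k = *-cancelˡ-≤ 3 (begin
  3 * (2 * 2-part (geometric p (1 + 2 * suc k))) ≡⟨ cong (λ w → 3 * (2 * w)) (2-part-geometric-1+2* p (suc k)) ⟩
  3 * (2 * (2-part (1 + p) * w))  ≡⟨ rearrange (2-part (1 + p)) w ⟩
  2 * 2-part (1 + p) * (3 * w)    ≤⟨ *-mono-≤ (*-monoʳ-≤ 2 (2-part-≤ (1 + p) (s≤s z≤n))) 3w≤ ⟩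
  2 * (1 + p) * (p * p) ^ suc k   ≤⟨ *-monoˡ-≤ ((p * p) ^ suc k) 2[1+p]≤3p ⟩
  3 * p * (p * p) ^ suc k         ≡⟨ *-assoc 3 p ((p * p) ^ suc k) ⟩
  3 * (p * (p * p) ^ suc k)       ≡⟨ cong (3 *_) (sym (^-1+2* p (suc k))) ⟩
  3 * p ^ (1 + 2 * suc k)         ∎)
  where
  open ≤-Reasoning
  p = 1 + 2 * suc v
  w = 2-part (geometric (p * p) (suc k))
  rearrange : ∀ a w → 3 * (2 * (a * w)) ≡ 2 * a * (3 * w)
  rearrange = solve-∀
  square : ∀ v → (1 + 2 * suc v) * (1 + 2 * suc v) ≡ 1 + 2 * (2 * (2 + (3 * v + v * v)))
  square = solve-∀
  slack : ∀ v → 3 * (1 + 2 * suc v) ≡ 2 * (2 + 2 * suc v) + (1 + 2 * v)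
  slack = solve-∀
  2[1+p]≤3p : 2 * (1 + p) ≤ 3 * p
  2[1+p]≤3p = subst (2 * (1 + p) ≤_) (sym (slack v)) (m≤m+n _ (1 + 2 * v))
  3w≤ : 3 * w ≤ (p * p) ^ suc k
  3w≤ = subst (λ r → 3 * 2-part (geometric r (suc k)) ≤ r ^ suc k) (sym (square v))
          (3*2-part-geometric≤ (suc k) (s≤s z≤n) (3 * v + v * v))

-- If p is even, or p is odd and the exponent `suc e` is even, the sum is odd. Odd exponents from 3
-- on are the previous lemma. For exponent 1 the sum is 1 + p, and its odd part decides.
geometric-power-of-2-or-small : ∀ p e → 2 ≤ p →
  (e ≡ 0 × ∃[ c ] 1 + p ≡ 2 ^ c) ⊎
  2 * 2-part (geometric p (suc e)) ≤ p ^ suc e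
geometric-power-of-2-or-small p e 2≤p with even-or-odd p
... | inj₁ (h , refl) = inj₂ (begin
  2 * 2-part (1 + 2 * h * geometric (2 * h) e)   ≡⟨ cong (λ x → 2 * 2-part (1 + x)) (*-assoc 2 h _) ⟩
  2 * 2-part (1 + 2 * (h * geometric (2 * h) e)) ≡⟨ cong (2 *_) (2-part-odd (h * geometric (2 * h) e)) ⟩
  2               ≤⟨ 2≤p ⟩
  2 * h           ≤⟨ m≤m^1+n (2 * h) e {{>-nonZero (<⇒≤ 2≤p)}} ⟩
  (2 * h) ^ suc e ∎)
  where open ≤-Reasoning
... | inj₂ (zero , refl) = contradiction 2≤p λ { (s≤s ()) }
... | inj₂ (suc v , refl) with even-or-odd (suc e)
...   | inj₁ (i , 1+e≡2i) = inj₂ (begin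
  2 * 2-part (geometric q (suc e)) ≡⟨ cong (λ j → 2 * 2-part (geometric q j)) 1+e≡2i ⟩
  2 * 2-part (geometric q (2 * i)) ≡⟨ cong (2 *_) (2-part-geometric-even (suc v) i) ⟩
  2                                ≤⟨ 2≤p ⟩
  q                                ≤⟨ m≤m^1+n q e ⟩
  q ^ suc e                        ∎)
  where
  open ≤-Reasoning
  q = 1 + 2 * suc v
...   | inj₂ (suc k , refl) = inj₂ (2*2-part-geometric-odd≤ v k)
...   | inj₂ (zero , refl) with 2^k*odd-decomposition (2 + 2 * suc v) (s≤s z≤n)
...     | c , zero , 1+p≡ = inj₁ (refl , c , trans 1+p≡ (*-identityʳ (2 ^ c)))
-- An odd part of at least 3 gives 1 + 2 * 2 ^ c ≤ 3 * 2 ^ c ≤ 1 + p; the added 1 is then stripped.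
...     | c , suc o , 1+p≡ = inj₂ (s≤s⁻¹ (begin
  1 + 2 * 2-part (geometric q 1)   ≡⟨ cong (λ x → 1 + 2 * 2-part (1 + x)) (*-identityʳ q) ⟩
  1 + 2 * 2-part (1 + q)           ≡⟨ cong (λ x → 1 + 2 * 2-part x) 1+p≡ ⟩
  1 + 2 * 2-part (2 ^ c * (1 + 2 * suc o)) ≡⟨ cong (λ x → 1 + 2 * x) (2-part-2^k*odd c (suc o)) ⟩
  1 + 2 * 2 ^ c                    ≤⟨ +-monoˡ-≤ (2 * 2 ^ c) (m^n>0 2 c) ⟩
  3 * 2 ^ c                        ≡⟨ *-comm 3 (2 ^ c) ⟩
  2 ^ c * 3                        ≤⟨ *-monoʳ-≤ (2 ^ c) (s≤s (*-monoʳ-≤ 2 (s≤s (z≤n {o})))) ⟩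
  2 ^ c * (1 + 2 * suc o)          ≡⟨ sym 1+p≡ ⟩
  1 + q                            ≡⟨ cong suc (sym (*-identityʳ q)) ⟩
  1 + q ^ 1                        ∎))
  where
  open ≤-Reasoning
  q = 1 + 2 * suc v

-- Divisors and σ after splitting off a prime power

∈-divisors⁺ : ∀ {d n} → 0 < n → d ∣ n → d ∈ divisors n
∈-divisors⁺ {zero}  0<n 0∣n = contradiction (0∣⇒≡0 0∣n) (>⇒≢ 0<n)
∈-divisors⁺ {suc d} {n} 0<n d∣n =
  ∈-filter⁺ (_∣? n) {xs = map suc (upTo n)} (∈-map⁺ suc (∈-upTo⁺ (∣⇒≤ {{>-nonZero 0<n}} d∣n))) d∣n

∈-divisors⁻ : ∀ {d n} → d ∈ divisors n → d ∣ n
∈-divisors⁻ {n = n} d∈ = proj₂ (∈-filter⁻ (_∣? n) {xs = map suc (upTo n)} d∈)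

divisors-unique : ∀ n → Unique (divisors n)
divisors-unique n = Unique.filter⁺ (_∣? n) (Unique.map⁺ suc-injective (Unique.upTo⁺ n))

sum-map-* : ∀ k xs → sum (map (k *_) xs) ≡ k * sum xs
sum-map-* k []       = sym (*-zeroʳ k)
sum-map-* k (x ∷ xs) = trans (cong (k * x +_) (sum-map-* k xs)) (sym (*-distribˡ-+ k x (sum xs)))

-- By Euclid's lemma each factor p must lie in the cofactor of `d`, so the factors p can be
-- cancelled one at a time.
∣p^k*m⇒∣m : ∀ {p d} k m → Prime p → p ∤ d → d ∣ p ^ k * m → d ∣ m
∣p^k*m⇒∣m zero m _ _ d∣ = subst (_ ∣_) (*-identityˡ m) d∣
∣p^k*m⇒∣m {p} {d} (suc k) m p-prime p∤d (divides q p^1+k*m≡q*d)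
  with euclidsLemma q d p-prime (subst (p ∣_) p^1+k*m≡q*d
         (subst (p ∣_) (sym (*-assoc p (p ^ k) m)) (m∣m*n (p ^ k * m))))
... | inj₂ p∣d = contradiction p∣d p∤d
... | inj₁ (divides r refl) = ∣p^k*m⇒∣m k m p-prime p∤d (divides r (*-cancelˡ-≡ _ _ p (begin
  p * (p ^ k * m) ≡⟨ sym (*-assoc p (p ^ k) m) ⟩
  p ^ suc k * m   ≡⟨ p^1+k*m≡q*d ⟩
  r * p * d       ≡⟨ rearrange r p d ⟩
  p * (r * d)     ∎)))
  where
  open ≡-Reasoning
  instance _ = prime⇒nonZero p-prime
  rearrange : ∀ r p d → r * p * d ≡ p * (r * d)
  rearrange = solve-∀

-- The divisors of p^(k+1) m prime to p are those of m, the others are p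
-- times the divisors of p^k m.
divisors-p^1+k*m : ∀ {p m} k → Prime p → 0 < m → p ∤ m →
  -- Both lists are free of repetitions, so having the same elements makes them permutations of each
  -- other, which is enough for equal sums.
  divisors (p ^ suc k * m) ↭ divisors m ++ map (p *_) (divisors (p ^ k * m))
divisors-p^1+k*m {p} {m} k p-prime 0<m p∤m = ∼bag⇒↭ (unique∧set⇒bag
  (divisors-unique (p ^ suc k * m))
  (Unique.++⁺ (divisors-unique m) (Unique.map⁺ (*-cancelˡ-≡ _ _ p) (divisors-unique (p ^ k * m))) disjoint)
  (mk⇔ to from))
  where
  instance
    _ = prime⇒nonZero p-prime
    _ = >-nonZero 0<m
    _ = m^n≢0 p k
  p^k*m>0 : ∀ j → 0 < p ^ j * m
  p^k*m>0 j = *-mono-≤ (m^n>0 p j) 0<m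
  disjoint : ∀ {d} → ¬ (d ∈ divisors m × d ∈ map (p *_) (divisors (p ^ k * m)))
  disjoint (d∈m , d∈) with ∈-map⁻ (p *_) d∈
  ... | c , _ , refl = p∤m (m*n∣⇒m∣ p c (∈-divisors⁻ d∈m))
  to : ∀ {d} → d ∈ divisors (p ^ suc k * m) → d ∈ divisors m ++ map (p *_) (divisors (p ^ k * m))
  to {d} d∈ with p ∣? d
  ... | yes (divides c refl) = ∈-++⁺ʳ (divisors m) (subst (_∈ map (p *_) (divisors (p ^ k * m))) (*-comm p c)
          (∈-map⁺ (p *_) (∈-divisors⁺ (p^k*m>0 k)
            (*-cancelˡ-∣ p (subst₂ _∣_ (*-comm c p) (*-assoc p (p ^ k) m) (∈-divisors⁻ d∈))))))
  ... | no p∤d = ∈-++⁺ˡ (∈-divisors⁺ 0<m (∣p^k*m⇒∣m (suc k) m p-prime p∤d (∈-divisors⁻ d∈)))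
  from : ∀ {d} → d ∈ divisors m ++ map (p *_) (divisors (p ^ k * m)) → d ∈ divisors (p ^ suc k * m)
  from d∈ with ∈-++⁻ (divisors m) d∈
  ... | inj₁ d∈m = ∈-divisors⁺ (p^k*m>0 (suc k)) (∣n⇒∣m*n (p ^ suc k) (∈-divisors⁻ d∈m))
  ... | inj₂ d∈p* with ∈-map⁻ (p *_) d∈p*
  ...   | c , c∈ , refl = ∈-divisors⁺ (p^k*m>0 (suc k))
            (subst (p * c ∣_) (sym (*-assoc p (p ^ k) m)) (*-monoʳ-∣ p (∈-divisors⁻ c∈)))

-- Summing the split divisor list gives σ (p ^ (k + 1) m) = σ m + p σ (p ^ k m), the Horner
-- recursion of `geometric`.
σ-p^k*m : ∀ {p m} k → Prime p → 0 < m → p ∤ m → σ (p ^ k * m) ≡ geometric p k * σ m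
σ-p^k*m {p} {m} zero _ _ _ = trans (cong σ (*-identityˡ m)) (sym (*-identityˡ (σ m)))
σ-p^k*m {p} {m} (suc k) p-prime 0<m p∤m = begin
  σ (p ^ suc k * m)                                              ≡⟨ sum-↭ (divisors-p^1+k*m k p-prime 0<m p∤m) ⟩
  sum (divisors m ++ map (p *_) (divisors (p ^ k * m)))          ≡⟨ sum-++ (divisors m) _ ⟩
  σ m + sum (map (p *_) (divisors (p ^ k * m)))                  ≡⟨ cong (σ m +_) (sum-map-* p (divisors (p ^ k * m))) ⟩
  σ m + p * σ (p ^ k * m)                                        ≡⟨ cong (λ s → σ m + p * s) (σ-p^k*m k p-prime 0<m p∤m) ⟩
  σ m + p * (geometric p k * σ m)                                ≡⟨ cong (σ m +_) (sym (*-assoc p (geometric p k) (σ m))) ⟩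
  geometric p (suc k) * σ m                                      ∎
  where open ≡-Reasoning

∈⇒≤sum : ∀ {x xs} → x ∈ xs → x ≤ sum xs
∈⇒≤sum {xs = y ∷ ys} (here refl) = m≤m+n y (sum ys)
∈⇒≤sum {xs = y ∷ ys} (there x∈) = ≤-trans (∈⇒≤sum x∈) (m≤n+m (sum ys) y)

σ>0 : ∀ {n} → 0 < n → 0 < σ n
σ>0 0<n = ∈⇒≤sum (∈-divisors⁺ 0<n (1∣ _))

2-part-σ-p^k*m : ∀ {p m} k → Prime p → 0 < m → p ∤ m →
  2-part (σ (p ^ k * m)) ≡ 2-part (geometric p k) * 2-part (σ m)
2-part-σ-p^k*m {p} {m} k p-prime 0<m p∤m = trans (cong 2-part (σ-p^k*m k p-prime 0<m p∤m))
  (2-part-* (geometric p k) (σ m) (geometric>0 p k) (σ>0 0<m))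

2-part-σ-mersenne* : ∀ {p m} c → 1 + p ≡ 2 ^ c → Prime p → 0 < m → p ∤ m →
  2-part (σ (p * m)) ≡ 2 ^ c * 2-part (σ m)
2-part-σ-mersenne* {p} {m} c 1+p≡2^c p-prime 0<m p∤m = begin
  2-part (σ (p * m))                          ≡⟨ cong (λ x → 2-part (σ (x * m))) (sym (*-identityʳ p)) ⟩
  2-part (σ (p ^ 1 * m))                      ≡⟨ 2-part-σ-p^k*m 1 p-prime 0<m p∤m ⟩
  2-part (geometric p 1) * 2-part (σ m)  ≡⟨ cong (λ x → 2-part (1 + x) * 2-part (σ m)) (*-identityʳ p) ⟩
  2-part (1 + p) * 2-part (σ m)  ≡⟨ cong (λ x → 2-part x * 2-part (σ m)) 1+p≡2^c ⟩
  2-part (2 ^ c) * 2-part (σ m)  ≡⟨ cong (_* 2-part (σ m)) (2-part-2^ c) ⟩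
  2 ^ c * 2-part (σ m) ∎
  where open ≡-Reasoning

-- Induction along the prime factors

p^k*m-decomposition : ∀ p → 2 ≤ p → ∀ n → 0 < n → ∃[ k ] ∃[ m ] n ≡ p ^ k * m × 0 < m × p ∤ m
p^k*m-decomposition p 2≤p = <-rec P step
  where
  P : ℕ → Set
  P n = 0 < n → ∃[ k ] ∃[ m ] n ≡ p ^ k * m × 0 < m × p ∤ m
  step : ∀ n → (∀ {m} → m < n → P m) → P n
  step n rec 0<n with p ∣? n
  ... | no p∤n = 0 , n , sym (*-identityˡ n) , 0<n , p∤n
  ... | yes (divides zero refl) = contradiction 0<n λ ()
  ... | yes (divides (suc q) refl) with rec (m<m*n (suc q) p 2≤p) (s≤s z≤n)
  ...   | k , m , q≡ , 0<m , p∤m = suc k , m , eq , 0<m , p∤m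
    where
    eq : suc q * p ≡ p ^ suc k * m
    eq = trans (*-comm (suc q) p) (trans (cong (p *_) q≡) (sym (*-assoc p (p ^ k) m)))

-- Peels off the primes of n in increasing order.
rough-induction : (P : ℕ → ℕ → Set) → (∀ p → P p 1) → (∀ {p n} → P (suc p) n → P p n) →
  (∀ {p m} k → Prime p → 0 < m → p ∤ m → P (suc p) m → P p (p ^ suc k * m)) →
  ∀ {p n} → 2 ≤ p → 0 < n → p Rough n → P p n
rough-induction P base weaken step {p} {n} 2≤p 0<n rough =
  go n p n (m<n+m n (<⇒≤ 2≤p)) 2≤p 0<n rough
  where
  -- Each round raises `p` and lowers the fuel by one while `n` does not grow, so `n < p + fuel`
  -- persists. Without fuel n < p, and a `p`-rough positive number below `p` is 1.
  go : ∀ fuel p n → n < p + fuel → 2 ≤ p → 0 < n → p Rough n → P p n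
  go zero p (suc zero) _ _ _ _ = base p
  go zero p n@(2+ _) n<p+0 _ _ rough = contradiction (rough⇒≤ rough) (<⇒≱ (subst (n <_) (+-identityʳ p) n<p+0))
  go (suc fuel) p n n<p+1+fuel 2≤p 0<n rough with p^k*m-decomposition p 2≤p n 0<n
  ... | k , m , refl , 0<m , p∤m = result k rough
    where
    instance
      _ = n>1⇒nonTrivial 2≤p
      _ = >-nonZero (<⇒≤ 2≤p)
      _ = m^n≢0 p k
    m-rough : suc p Rough m
    m-rough = ∤⇒rough-suc p∤m (rough∧∣⇒rough rough (n∣m*n (p ^ k)))
    ih : P (suc p) m
    ih = go fuel (suc p) m
      (subst (m <_) (+-suc p fuel) (≤-<-trans (m≤n*m m (p ^ k)) n<p+1+fuel))
      (m≤n⇒m≤1+n 2≤p) 0<m m-rough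
    result : ∀ k → p Rough (p ^ k * m) → P p (p ^ k * m)
    result zero    _ = weaken (subst (P (suc p)) (sym (*-identityˡ m)) ih)
    -- Here `p` divides a `p`-rough number, so it has no smaller nontrivial divisor and is prime.
    result (suc k) r = step k (rough∧∣⇒prime r (∣m⇒∣m*n m (m∣m*n (p ^ k)))) 0<m p∤m ih

-- Products of distinct Mersenne primes

mersenne-* : ∀ {p m} c → 1 + p ≡ 2 ^ c → Prime p → p ∤ m →
  ProductOfDistinctMersennePrimes m → ProductOfDistinctMersennePrimes (p * m)
mersenne-* {p} c 1+p≡2^c p-prime p∤m (ps , mersenne , unique , refl) =
  p ∷ ps , (p-prime , c , 0<c c 1+p≡2^c , cong pred 1+p≡2^c) ∷ mersenne ,
  -- An occurrence of `p` in `ps` would make `p` divide their product `m`.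
  All.tabulate (λ { p∈ps refl → p∤m (∈⇒∣product p∈ps) }) ∷ unique , refl
  where
  0<c : ∀ c → 1 + p ≡ 2 ^ c → 0 < c
  0<c (suc c) _ = s≤s z≤n
  0<c zero 1+p≡1 = contradiction (subst Prime (suc-injective 1+p≡1) p-prime) ¬prime[0]

mersenne-exponent : ∀ {p} → MersennePrime p → ∃[ c ] 1 + p ≡ 2 ^ c
mersenne-exponent (_ , c , _ , refl) = c , m+[n∸m]≡n (m^n>0 2 c)

-- Each prime p = 2 ^ c - 1 contributes p to `n` but 2 ^ c to the 2-part; distinctness supplies the
-- coprimality that multiplicativity requires.
productOfDistinctMersennePrimes⇒≤ : ∀ {n} → ProductOfDistinctMersennePrimes n → n ≤ 2-part (σ n)
productOfDistinctMersennePrimes⇒≤ (ps , mersenne , unique , refl) = go ps mersenne unique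
  where
  go : ∀ ps → All MersennePrime ps → Unique ps → product ps ≤ 2-part (σ (product ps))
  go [] _ _ = s≤s z≤n
  go (p ∷ ps) (p-mersenne@(p-prime , _) ∷ mersenne) unique@(_ ∷ unique-ps) with mersenne-exponent p-mersenne
  ... | c , 1+p≡2^c = begin
    p * product ps                     ≤⟨ *-mono-≤ (≤-trans (n≤1+n p) (≤-reflexive 1+p≡2^c)) (go ps mersenne unique-ps) ⟩
    2 ^ c * 2-part (σ (product ps))    ≡⟨ sym (2-part-σ-mersenne* c 1+p≡2^c p-prime (productOfPrimes≥1 primes) p∤ps) ⟩
    2-part (σ (p * product ps))        ∎
    where
    open ≤-Reasoning
    primes : All Prime ps
    primes = All.map proj₁ mersenne
    p∤ps : p ∤ product ps
    p∤ps p∣ps = Unique.Unique[x∷xs]⇒x∉xs unique (factorisationHasAllPrimeFactors p-prime p∣ps primes)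

-- Bounding the ratio of the 2-part of σ n to n

-- Says x / n < B / (B − 1) for B = 2 ^ b.  A Mersenne prime 2 ^ c − 1 ≥ B has
-- c > b.  With C = 2 ^ c ≥ 2 B, multiplying a ratio below C / (C − 1) by
-- C / (C − 1) keeps it below B / (B − 1), because (C / (C − 1))² < B / (B − 1).
RatioBound : ℕ → ℕ → ℕ → Set
RatioBound p x n = ∀ b → 2 ^ b ≤ p → x * pred (2 ^ b) < n * 2 ^ b

ratioBound-≤ : ∀ {p x y n} → x ≤ y → RatioBound p y n → RatioBound p x n
ratioBound-≤ x≤y bound b 2^b≤p = ≤-<-trans (*-monoˡ-≤ (pred (2 ^ b)) x≤y) (bound b 2^b≤p)

ratioBound-pred : ∀ {p x n} → RatioBound (suc p) x n → RatioBound p x n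
ratioBound-pred bound b 2^b≤p = bound b (m≤n⇒m≤1+n 2^b≤p)

ratioBound-*ˡ : ∀ {p x n} k .{{_ : NonZero k}} → RatioBound p x n → RatioBound p (k * x) (k * n)
ratioBound-*ˡ {x = x} {n} k bound b 2^b≤p =
  subst₂ _<_ (sym (*-assoc k x (pred (2 ^ b)))) (sym (*-assoc k n (2 ^ b))) (*-monoʳ-< k (bound b 2^b≤p))

-- The hypothesis is taken at b = c, where it reads x / m < (1 + p) / p. The extra factor `p` on
-- both sides clears this denominator, and `key` is the squared-ratio inequality.
ratioBound-mersenne : ∀ {p x m} c → 1 + p ≡ 2 ^ c → 0 < m →
  RatioBound (suc p) x m → RatioBound p (2 ^ c * x) (p * m)
ratioBound-mersenne {p} {x} {m} c 1+p≡2^c 0<m bound b 2^b≤p = *-cancelˡ-< p _ _ (begin-strict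
  p * (2 ^ c * x * B′)     ≡⟨ cong (λ q → p * (q * x * B′)) (sym 1+p≡2^c) ⟩
  p * ((1 + p) * x * B′)   ≡⟨ rearrange₁ p x B′ ⟩
  (1 + p) * B′ * (x * p)   ≤⟨ *-monoʳ-≤ ((1 + p) * B′) (<⇒≤ x*p<m*[1+p]) ⟩
  (1 + p) * B′ * (m * (1 + p)) ≡⟨ rearrange₂ p m B′ ⟩
  m * ((1 + p) * (1 + p) * B′) <⟨ *-monoʳ-< m key ⟩
  m * (p * p * (1 + B′))    ≡⟨ cong (λ B → m * (p * p * B)) 1+B′≡2^b ⟩
  m * (p * p * 2 ^ b)       ≡⟨ rearrange₃ p m (2 ^ b) ⟩
  p * (p * m * 2 ^ b)      ∎)
  where
  open ≤-Reasoning
  instance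
    _ = >-nonZero 0<m
    _ = m^n≢0 2 b
  B′ = pred (2 ^ b)
  1+B′≡2^b : 1 + B′ ≡ 2 ^ b
  1+B′≡2^b = suc-pred (2 ^ b)
  x*p<m*[1+p] : x * p < m * (1 + p)
  x*p<m*[1+p] = subst (λ q → x * pred q < m * q) (sym 1+p≡2^c) (bound c (≤-reflexive (sym 1+p≡2^c)))
  b<c : b < c
  b<c = ≰⇒> λ c≤b → <⇒≱ (≤-<-trans 2^b≤p (≤-reflexive 1+p≡2^c)) (^-monoʳ-≤ 2 c≤b)
  2*[1+B′]≤1+p : 2 * (1 + B′) ≤ 1 + p
  2*[1+B′]≤1+p = subst₂ _≤_ (cong (2 *_) (sym 1+B′≡2^b)) (sym 1+p≡2^c) (^-monoʳ-≤ 2 b<c)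
  rearrange₁ : ∀ p x B′ → p * ((1 + p) * x * B′) ≡ (1 + p) * B′ * (x * p)
  rearrange₁ = solve-∀
  rearrange₂ : ∀ p m B′ → (1 + p) * B′ * (m * (1 + p)) ≡ m * ((1 + p) * (1 + p) * B′)
  rearrange₂ = solve-∀
  rearrange₃ : ∀ p m B → m * (p * p * B) ≡ p * (p * m * B)
  rearrange₃ = solve-∀
  -- Here r is the excess of 1 + p over 2 * (1 + B′); the last summand is positive, which makes
  -- `key` strict.
  gap : ∀ B′ r → let p = 1 + 2 * B′ + r in
    p * p * (1 + B′) ≡ (1 + p) * (1 + p) * B′ + (1 + (B′ + r + p * r))
  gap = solve-∀
  key : (1 + p) * (1 + p) * B′ < p * p * (1 + B′)
  key with m≤n⇒∃[o]m+o≡n (s≤s⁻¹ (subst (_≤ 1 + p) (*-suc 2 B′) 2*[1+B′]≤1+p))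
  ... | r , refl = subst ((1 + p) * (1 + p) * B′ <_) (sym (gap B′ r)) (m<m+n _ (s≤s z≤n))

-- At p = 2 and b = 1 the bounds become V < 2 n and V < n, with V = `2-part (σ n)`. The ratio form
-- for general `p` leaves room for the Mersenne primes still to come.
MersenneOrSmall : ℕ → ℕ → Set
MersenneOrSmall p n =
  (ProductOfDistinctMersennePrimes n × RatioBound p (2-part (σ n)) n) ⊎
  RatioBound p (2 * 2-part (σ n)) n

-- A Mersenne prime factor stays within the current alternative; any other prime power halves the
-- ratio at least and leads to the second one.
rough⇒mersenneOrSmall : ∀ {p n} → 2 ≤ p → 0 < n → p Rough n → MersenneOrSmall p n
rough⇒mersenneOrSmall = rough-induction MersenneOrSmall base weaken step
  where
  base : ∀ p → MersenneOrSmall p 1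
  base p = inj₁ (([] , [] , [] , refl) , λ b _ →
    *-monoʳ-< 1 (≤-reflexive (suc-pred (2 ^ b) {{m^n≢0 2 b}})))
  weaken : ∀ {p n} → MersenneOrSmall (suc p) n → MersenneOrSmall p n
  weaken {p} {n} (inj₁ (product , bound)) = inj₁ (product , ratioBound-pred {p} {2-part (σ n)} {n} bound)
  weaken {p} {n} (inj₂ bound) = inj₂ (ratioBound-pred {p} {2 * 2-part (σ n)} {n} bound)
  bound : ∀ {p n} → MersenneOrSmall p n → RatioBound p (2-part (σ n)) n
  bound (inj₁ (_ , bound)) = bound
  bound {p} {n} (inj₂ bound) = ratioBound-≤ {p} {n = n} (m≤m+n (2-part (σ n)) _) bound
  mersenne-step : ∀ {p m} c → 1 + p ≡ 2 ^ c → Prime p → 0 < m → p ∤ m →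
    MersenneOrSmall (suc p) m → MersenneOrSmall p (p * m)
  mersenne-step {p} {m} c 1+p≡2^c p-prime 0<m p∤m (inj₁ (product , bound)) =
    inj₁ (mersenne-* c 1+p≡2^c p-prime p∤m product ,
      subst (λ x → RatioBound p x (p * m)) (sym (2-part-σ-mersenne* c 1+p≡2^c p-prime 0<m p∤m))
        (ratioBound-mersenne {x = 2-part (σ m)} c 1+p≡2^c 0<m bound))
  mersenne-step {p} {m} c 1+p≡2^c p-prime 0<m p∤m (inj₂ bound) =
    inj₂ (subst (λ x → RatioBound p x (p * m))
      (trans (swap (2 ^ c) (2-part (σ m))) (cong (2 *_) (sym (2-part-σ-mersenne* c 1+p≡2^c p-prime 0<m p∤m))))
        (ratioBound-mersenne {x = 2 * 2-part (σ m)} c 1+p≡2^c 0<m bound))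
    where
    swap : ∀ a x → a * (2 * x) ≡ 2 * (a * x)
    swap = solve-∀
  step : ∀ {p m} k → Prime p → 0 < m → p ∤ m → MersenneOrSmall (suc p) m → MersenneOrSmall p (p ^ suc k * m)
  step {p} {m} k p-prime 0<m p∤m ih
    with geometric-power-of-2-or-small p k (nonTrivial⇒n>1 p {{prime⇒nonTrivial p-prime}})
  ... | inj₁ (refl , c , 1+p≡2^c) = subst (λ x → MersenneOrSmall p (x * m)) (sym (*-identityʳ p))
          (mersenne-step c 1+p≡2^c p-prime 0<m p∤m ih)
  -- Both alternatives for `m` yield the undoubled bound, and the factor 2 lost by `q` restores the
  -- doubling.
  ... | inj₂ 2g≤p^1+k = inj₂ (ratioBound-≤ {p} {n = q * m} 2*2-part≤
          (ratioBound-*ˡ {p} {2-part (σ m)} {m} q (ratioBound-pred {p} {2-part (σ m)} {m} (bound ih))))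
    where
    open ≤-Reasoning
    q = p ^ suc k
    instance
      _ = prime⇒nonZero p-prime
      _ = m^n≢0 p (suc k)
    2*2-part≤ : 2 * 2-part (σ (q * m)) ≤ q * 2-part (σ m)
    2*2-part≤ = begin
      2 * 2-part (σ (q * m))                            ≡⟨ cong (2 *_) (2-part-σ-p^k*m (suc k) p-prime 0<m p∤m) ⟩
      2 * (2-part (geometric p (suc k)) * 2-part (σ m)) ≡⟨ sym (*-assoc 2 (2-part (geometric p (suc k))) _) ⟩
      2 * 2-part (geometric p (suc k)) * 2-part (σ m)   ≤⟨ *-monoˡ-≤ (2-part (σ m)) 2g≤p^1+k ⟩
      q * 2-part (σ m)                                  ∎

-- Passage to logarithms and conclusion

-- Induction by halving: 2 ^ (k + 1) < n gives 2 ^ k < ⌈n / 2⌉, whose logarithm, rounded up, is one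
-- less.
2^k<n⇒k<⌈log₂n⌉ : ∀ k {n} → 2 ^ k < n → k < ⌈log₂ n ⌉
2^k<n⇒k<⌈log₂n⌉ zero    1<n = ⌈log₂⌉-mono-≤ 1<n
2^k<n⇒k<⌈log₂n⌉ (suc k) {n} 2^1+k<n = m<n∸1⇒1+m<n (subst (k <_) (⌈log₂⌈n/2⌉⌉≡⌈log₂n⌉∸1 n)
  -- As `⌈ n /2⌉` is `⌊ suc n /2⌋`, it suffices to halve 2 + 2 ^ (k + 1) ≤ 1 + n.
  (2^k<n⇒k<⌈log₂n⌉ k (subst (_≤ ⌈ n /2⌉) half (⌊n/2⌋-mono (s≤s 2^1+k<n)))))
  where
  m<n∸1⇒1+m<n : ∀ {m n} → m < n ∸ 1 → suc m < n
  m<n∸1⇒1+m<n {n = suc n} m<n = s≤s m<n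
  half : ⌊ 2 + 2 ^ suc k /2⌋ ≡ suc (2 ^ k)
  half = cong suc (trans (cong (λ x → ⌊ 2 ^ k + x /2⌋) (+-identityʳ (2 ^ k))) (sym (n≡⌊n+n/2⌋ (2 ^ k))))

n≤2^k⇒⌈log₂n⌉≤k : ∀ {n} k → n ≤ 2 ^ k → ⌈log₂ n ⌉ ≤ k
n≤2^k⇒⌈log₂n⌉≤k k n≤2^k = subst (_ ≤_) (⌈log₂2^n⌉≡n k) (⌈log₂⌉-mono-≤ n≤2^k)

2^k<2*n⇒k≤⌈log₂n⌉ : ∀ k n → 2 ^ k < 2 * n → k ≤ ⌈log₂ n ⌉
2^k<2*n⇒k≤⌈log₂n⌉ zero    _ _ = z≤n
2^k<2*n⇒k≤⌈log₂n⌉ (suc k) n 2^1+k<2*n = 2^k<n⇒k<⌈log₂n⌉ k {n} (*-cancelˡ-< 2 _ _ 2^1+k<2*n)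

theorem1p3 : (n : ℕ) → .{{_ : NonZero n}} →
    (ν₂ (σ n) ≤ ⌈log₂ n ⌉) ×
    ((ν₂ (σ n) ≡ ⌈log₂ n ⌉) ⇔ ProductOfDistinctMersennePrimes n)
theorem1p3 n with rough⇒mersenneOrSmall ≤-refl (n≢0⇒n>0 (≢-nonZero⁻¹ n)) 2-rough
... | inj₁ (product , bound) = ν≤ , mk⇔ (λ _ → product)
        λ product → ≤-antisym ν≤ (n≤2^k⇒⌈log₂n⌉≤k (ν₂ (σ n)) (productOfDistinctMersennePrimes⇒≤ product))
  where
  ν≤ : ν₂ (σ n) ≤ ⌈log₂ n ⌉
  -- For b = 1 the ratio bound is B / (B - 1) = 2.
  ν≤ = 2^k<2*n⇒k≤⌈log₂n⌉ (ν₂ (σ n)) n (subst₂ _<_ (*-identityʳ _) (*-comm n 2) (bound 1 ≤-refl))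
... | inj₂ bound = <⇒≤ ν< , mk⇔ (λ ν≡ → contradiction ν≡ (<⇒≢ ν<))
        λ product → contradiction (productOfDistinctMersennePrimes⇒≤ product) (<⇒≱ small)
  where
  small : 2-part (σ n) < n
  small = *-cancelˡ-< 2 _ _ (subst₂ _<_ (*-identityʳ _) (*-comm n 2) (bound 1 ≤-refl))
  ν< : ν₂ (σ n) < ⌈log₂ n ⌉
  ν< = 2^k<n⇒k<⌈log₂n⌉ (ν₂ (σ n)) small
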